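{- Let $Q_n$ denote the $n$-dimensional hypercube graph and let $\mathrm{ex}(Q_n,C_4)$ denote the maximum number of edges of a subgraph of $Q_n$ containing no cycle of length four. Then (i) $\mathrm{ex}(Q_7,C_4)\ge 304$; (ii) $\mathrm{ex}(Q_8,C_4)\ge 680$.
   Context: The hypercube $Q_n$ has vertex set $\{0,1\}^n$, two vertices being adjacent iff they differ in exactly one coordinate; it has $2^n$ vertices and $n2^{n-1}$ edges. $\mathrm{ex}(Q_n,C_4)=\max\{|E(G)|: G\subseteq Q_n,\ G \text{ contains no } C_4\}$. -}

module Defs where

open import Data.Bool using (Bool; true; false; if_then_else_)
open import Data.Bool.Properties using () renaming (_≟_ to _≟B_)
open import Data.Nat using (ℕ; zero; suc; _+_; _≤_)
open import Data.Vec using (Vec; []; _∷_)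
open import Data.List using (List; length)
open import Data.List.Membership.Propositional using (_∈_)
open import Data.List.Relation.Unary.All using (All)
open import Data.List.Relation.Unary.AllPairs using (AllPairs)
open import Data.Product using (_×_; _,_; ∃-syntax)
open import Data.Sum using (_⊎_)
open import Data.Empty using (⊥)
open import Relation.Nullary using (¬_; does)
open import Relation.Binary.PropositionalEquality using (_≡_; _≢_)

Vertex : ℕ → Set
Vertex n = Vec Bool n

hamming : ∀ {n} → Vertex n → Vertex n → ℕ
hamming [] [] = 0
hamming (x ∷ xs) (y ∷ ys) = (if does (x ≟B y) then 0 else 1) + hamming xs ys

QAdj : ∀ {n} → Vertex n → Vertex n → Set
QAdj u v = hamming u v ≡ 1

Edge : ℕ → Set
Edge n = Vertex n × Vertex n

SameEdge : ∀ {n} → Edge n → Edge n → Set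
SameEdge (u , v) (x , y) = (u ≡ x × v ≡ y) ⊎ (u ≡ y × v ≡ x)

-- A subgraph G ⊆ Q_n is given by its edge set, a duplicate-free list of
-- edges of Q_n (|E(G)| = length of the list).
IsQSubgraph : (n : ℕ) → List (Edge n) → Set
IsQSubgraph n es =
  All (λ e → QAdj (Data.Product.proj₁ e) (Data.Product.proj₂ e)) es
  × AllPairs (λ e f → ¬ SameEdge e f) es

HasEdge : ∀ {n} → List (Edge n) → Vertex n → Vertex n → Set
HasEdge es u v = (u , v) ∈ es ⊎ (v , u) ∈ es

ContainsC4 : ∀ {n} → List (Edge n) → Set
ContainsC4 {n} es = ∃[ a ] ∃[ b ] ∃[ c ] ∃[ d ]
  ((a ≢ b) × (a ≢ c) × (a ≢ d) × (b ≢ c) × (b ≢ d) × (c ≢ d))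
  × HasEdge es a b × HasEdge es b c × HasEdge es c d × HasEdge es d a

C4Free : ∀ {n} → List (Edge n) → Set
C4Free es = ¬ ContainsC4 es

exQC4≥ : ℕ → ℕ → Set
exQC4≥ n k = ∃[ es ] (IsQSubgraph n es × C4Free es × k ≤ length es)

{-# OPTIONS --safe #-}

-- Both bounds come from explicit graphs, found by simulated annealing among
-- the subgraphs of Q₇ and Q₈ invariant under a cyclic group of automorphisms
-- (of order 8 and 6 respectively).  Split Q_{n+1} along its first coordinate
-- into two copies of Q_n joined by a matching ("rungs").  A subgraph is
-- C₄-free iff its two sides are and no edge present in both sides has rungs
-- at both ends; applied recursively this is a finite check, done by evaluation.
module Submission where

open import Defs
open import Data.Bool using (Bool; true; false; T; if_then_else_)
open import Data.Bool.Properties using (T?)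
open import Data.Empty using (⊥)
open import Data.Fin using (Fin; zero; suc)
open import Data.List using (List; []; [_]; _++_; map; filter; length)
open import Data.List.Membership.Propositional using (_∈_)
open import Data.List.Membership.Propositional.Properties using (∈-map⁻; ∈-++⁻; ∈-filter⁻)
open import Data.List.Relation.Unary.All as All using (All; [])
import Data.List.Relation.Unary.All.Properties as All
open import Data.List.Relation.Unary.AllPairs as AllPairs using (AllPairs; []; _∷_)
import Data.List.Relation.Unary.AllPairs.Properties as AllPairs
open import Data.List.Relation.Unary.Unique.Propositional using (Unique)
import Data.List.Relation.Unary.Unique.Propositional.Properties as Unique
open import Data.Nat using (ℕ; zero; suc; _+_; _*_; _^_; _≤ᵇ_; _≡ᵇ_)
open import Data.Nat.DivMod using (_/_; _%_)
open import Data.Nat.Properties using (≤ᵇ⇒≤; m^n≢0)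
open import Data.Product as Product using (_×_; _,_; proj₁; proj₂)
open import Data.Sum using (inj₁; inj₂)
open import Data.Unit using (⊤; tt)
open import Data.Vec using (Vec; []; _∷_; lookup)
open import Data.Vec.Properties using (∷-injectiveʳ)
open import Function using (_∘_; case_of_)
open import Relation.Nullary using (¬_; Dec; yes; ¬?)
open import Relation.Nullary.Decidable using (True; toWitness; _×-dec_; map′)
open import Relation.Unary using (Decidable)
open import Relation.Binary.PropositionalEquality using (_≡_; _≢_; refl; cong)

private
  variable
    n : ℕ

-- The value at (v , i) says whether the edge from v in direction i is
-- present; only its values at the endpoints v with vᵢ = false are used.
Graph : ℕ → Set
Graph n = Vertex n → Fin n → Bool

side : Bool → Graph (suc n) → Graph n
side b P v i = P (b ∷ v) (suc i)

rungs : Graph (suc n) → Vertex n → Bool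
rungs P v = P (false ∷ v) zero

allVertices : ∀ n → List (Vertex n)
allVertices zero    = [ [] ]
allVertices (suc n) = map (false ∷_) (allVertices n) ++ map (true ∷_) (allVertices n)

extend : Bool → Edge n → Edge (suc n)
extend b (u , v) = b ∷ u , b ∷ v

rung : Vertex n → Edge (suc n)
rung v = false ∷ v , true ∷ v

rungList : Graph (suc n) → List (Vertex n)
rungList P = filter (T? ∘ rungs P) (allVertices _)

-- Each edge is listed in one orientation only, starting from its end with `false` in the coordinate
-- that changes.
edges : Graph n → List (Edge n)
edges {zero}  P = []
edges {suc n} P =
     map (extend false) (edges (side false P))
  ++ map (extend true) (edges (side true P))
  ++ map rung (rungList P)

hamming-refl : (v : Vertex n) → hamming v v ≡ 0
hamming-refl []          = refl
hamming-refl (false ∷ v) = hamming-refl v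
hamming-refl (true ∷ v)  = hamming-refl v

edges-QAdj : (P : Graph n) → All (λ e → QAdj (proj₁ e) (proj₂ e)) (edges P)
edges-QAdj {zero}  P = []
edges-QAdj {suc n} P =
  All.++⁺ (All.map⁺ (edges-QAdj (side false P)))
  (All.++⁺ (All.map⁺ (edges-QAdj (side true P)))
           (All.map⁺ (All.universal (cong suc ∘ hamming-refl) (rungList P))))

allVertices-unique : ∀ n → Unique (allVertices n)
allVertices-unique zero    = [] ∷ []
allVertices-unique (suc n) =
  Unique.++⁺ (Unique.map⁺ ∷-injectiveʳ (allVertices-unique n))
             (Unique.map⁺ ∷-injectiveʳ (allVertices-unique n))
             λ (p , q) → case ∈-map⁻ _ p , ∈-map⁻ _ q of λ { ((_ , _ , refl) , (_ , _ , ())) }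

extend-SameEdge⁻ : ∀ b {e f : Edge n} → SameEdge (extend b e) (extend b f) → SameEdge e f
extend-SameEdge⁻ b (inj₁ (refl , refl)) = inj₁ (refl , refl)
extend-SameEdge⁻ b (inj₂ (refl , refl)) = inj₂ (refl , refl)

rung-SameEdge⁻ : {u v : Vertex n} → SameEdge (rung u) (rung v) → u ≡ v
rung-SameEdge⁻ (inj₁ (refl , _)) = refl

-- Serves to compare two different blocks of `edges`, where any member of one is distinct from any
-- member of the other.
map-related : {A B C : Set} {R : B → B → Set} {f : A → B} {g : C → B} →
              (∀ x y → R (f x) (g y)) → ∀ xs ys → All (λ b → All (R b) (map g ys)) (map f xs)
map-related r xs ys = All.map⁺ (All.universal (λ x → All.map⁺ (All.universal (r x) ys)) xs)

-- In the three blocks the first coordinates of the ends are (`false`, `false`), (`true`, `true`)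
-- and (`false`, `true`), so edges of different blocks differ in either orientation. Within a side
-- the recursion applies; distinct rungs come from distinct vertices.
edges-distinct : (P : Graph n) → AllPairs (λ e f → ¬ SameEdge e f) (edges P)
edges-distinct {zero}  P = []
edges-distinct {suc n} P =
  AllPairs.++⁺ (extended false)
    (AllPairs.++⁺ (extended true)
      (AllPairs.map⁺ (AllPairs.map (_∘ rung-SameEdge⁻)
        (Unique.filter⁺ (T? ∘ rungs P) (allVertices-unique n))))
      (map-related (λ { _ _ (inj₁ (() , _)) ; _ _ (inj₂ (_ , ())) }) E₁ (rungList P)))
    (All.zipWith (Product.uncurry All.++⁺)
      ( map-related (λ { _ _ (inj₁ (() , _)) ; _ _ (inj₂ (() , _)) }) E₀ E₁
      , map-related (λ { _ _ (inj₁ (_ , ())) ; _ _ (inj₂ (() , _)) }) E₀ (rungList P)))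
  where
  E₀ = edges (side false P)
  E₁ = edges (side true P)
  extended : ∀ b → AllPairs (λ e f → ¬ SameEdge e f) (map (extend b) (edges (side b P)))
  extended b = AllPairs.map⁺ (AllPairs.map (_∘ extend-SameEdge⁻ b) (edges-distinct (side b P)))

-- A recursive counterpart of `HasEdge (edges P)`: splitting on the first coordinates turns it at
-- once into adjacency in a side, or into a rung with equal tails.
Adj : Graph n → Vertex n → Vertex n → Set
Adj P []          []          = ⊥
Adj P (false ∷ u) (false ∷ v) = Adj (side false P) u v
Adj P (true ∷ u)  (true ∷ v)  = Adj (side true P) u v
Adj P (false ∷ u) (true ∷ v)  = u ≡ v × T (rungs P u)
Adj P (true ∷ u)  (false ∷ v) = u ≡ v × T (rungs P u)

Adj-sym : (P : Graph n) (u v : Vertex n) → Adj P u v → Adj P v u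
Adj-sym P []          []          = λ ()
Adj-sym P (false ∷ u) (false ∷ v) = Adj-sym (side false P) u v
Adj-sym P (true ∷ u)  (true ∷ v)  = Adj-sym (side true P) u v
Adj-sym P (false ∷ u) (true ∷ v)  (refl , r) = refl , r
Adj-sym P (true ∷ u)  (false ∷ v) (refl , r) = refl , r

∈-edges⇒Adj : (P : Graph n) {u v : Vertex n} → (u , v) ∈ edges P → Adj P u v
∈-edges⇒Adj {suc n} P e∈ with ∈-++⁻ (map (extend false) (edges (side false P))) e∈
... | inj₁ e∈₀ = case ∈-map⁻ _ e∈₀ of λ { (_ , p , refl) → ∈-edges⇒Adj (side false P) p }
... | inj₂ e∈′ with ∈-++⁻ (map (extend true) (edges (side true P))) e∈′
...   | inj₁ e∈₁ = case ∈-map⁻ _ e∈₁ of λ { (_ , p , refl) → ∈-edges⇒Adj (side true P) p }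
...   | inj₂ e∈ᵣ = case ∈-map⁻ _ e∈ᵣ of λ
  { (_ , p , refl) → refl , proj₂ (∈-filter⁻ (T? ∘ rungs P) {xs = allVertices n} p) }

HasEdge⇒Adj : (P : Graph n) {u v : Vertex n} → HasEdge (edges P) u v → Adj P u v
HasEdge⇒Adj P (inj₁ p) = ∈-edges⇒Adj P p
HasEdge⇒Adj P {u} {v} (inj₂ p) = Adj-sym P v u (∈-edges⇒Adj P p)

-- Here `P` and `Q` are the two sides of a larger graph and `S` marks its rungs; an edge common to
-- both sides with both ends in `S` would close a 4-cycle. Such an edge lies in one half of the
-- smaller cube or is itself a rung there, so the recursion visits edges rather than all pairs of
-- vertices.
NoPrism : Graph n → Graph n → (Vertex n → Bool) → Set
NoPrism {zero}  P Q S = ⊤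
NoPrism {suc n} P Q S =
    (∀ b → NoPrism (side b P) (side b Q) (S ∘ (b ∷_)))
  × (∀ v → ¬ (T (rungs P v) × T (rungs Q v) × T (S (false ∷ v)) × T (S (true ∷ v))))

NoSquare : Graph n → Set
NoSquare {zero}  P = ⊤
NoSquare {suc n} P = (∀ b → NoSquare (side b P)) × NoPrism (side false P) (side true P) (rungs P)

noPrism⇒¬prism : (P Q : Graph n) (S : Vertex n → Bool) → NoPrism P Q S →
                 ∀ u v → Adj P u v → Adj Q u v → T (S u) → T (S v) → ⊥
noPrism⇒¬prism P Q S np [] [] ()
noPrism⇒¬prism P Q S (np , _) (false ∷ u) (false ∷ v) = noPrism⇒¬prism _ _ _ (np false) u v
noPrism⇒¬prism P Q S (np , _) (true ∷ u)  (true ∷ v)  = noPrism⇒¬prism _ _ _ (np true) u v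
noPrism⇒¬prism P Q S (_ , nr) (false ∷ u) (true ∷ v) (refl , p) (_ , q) s t = nr u (p , q , s , t)
-- The edge is now traversed from its `true` end, so the marks `s` and `t` trade places.
noPrism⇒¬prism P Q S (_ , nr) (true ∷ u) (false ∷ v) (refl , p) (_ , q) s t = nr u (p , q , t , s)

-- Going around a 4-cycle, the first coordinate changes 0, 2 or 4 times, and
-- two consecutive changes would lead back to the same vertex.
noSquare⇒¬cycle : (P : Graph n) → NoSquare P → ∀ a b c d → a ≢ c → b ≢ d →
                  Adj P a b → Adj P b c → Adj P c d → Adj P d a → ⊥
noSquare⇒¬cycle P ns [] [] [] [] _ _ ()
noSquare⇒¬cycle P (ns , _) (false ∷ a) (false ∷ b) (false ∷ c) (false ∷ d) a≢c b≢d =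
  noSquare⇒¬cycle _ (ns false) a b c d (a≢c ∘ cong (false ∷_)) (b≢d ∘ cong (false ∷_))
noSquare⇒¬cycle P (ns , _) (true ∷ a) (true ∷ b) (true ∷ c) (true ∷ d) a≢c b≢d =
  noSquare⇒¬cycle _ (ns true) a b c d (a≢c ∘ cong (true ∷_)) (b≢d ∘ cong (true ∷_))
-- In this and the next three clauses two opposite steps are rungs; the other two then project to a
-- single edge, present in both sides.
noSquare⇒¬cycle P (_ , np) (false ∷ a) (false ∷ b) (true ∷ c) (true ∷ d) _ _ ab (refl , s) cd (refl , t) =
  noPrism⇒¬prism _ _ _ np a b ab (Adj-sym (side true P) b a cd) t s
noSquare⇒¬cycle P (_ , np) (true ∷ a) (true ∷ b) (false ∷ c) (false ∷ d) _ _ ab (refl , s) cd (refl , t) =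
  noPrism⇒¬prism _ _ _ np a b (Adj-sym (side false P) b a cd) ab t s
noSquare⇒¬cycle P (_ , np) (false ∷ a) (true ∷ b) (true ∷ c) (false ∷ d) _ _ (refl , s) bc (refl , t) da =
  noPrism⇒¬prism _ _ _ np b c (Adj-sym (side false P) c b da) bc s t
noSquare⇒¬cycle P (_ , np) (true ∷ a) (false ∷ b) (false ∷ c) (true ∷ d) _ _ (refl , s) bc (refl , t) da =
  noPrism⇒¬prism _ _ _ np b c bc (Adj-sym (side true P) c b da) s t
noSquare⇒¬cycle P _ (false ∷ _) (true ∷ _) (false ∷ _) _ a≢c _ (refl , _) (refl , _) = λ _ _ → a≢c refl
noSquare⇒¬cycle P _ (true ∷ _) (false ∷ _) (true ∷ _) _ a≢c _ (refl , _) (refl , _) = λ _ _ → a≢c refl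
noSquare⇒¬cycle P _ _ (false ∷ _) (true ∷ _) (false ∷ _) _ b≢d _ (refl , _) (refl , _) _ = b≢d refl
noSquare⇒¬cycle P _ _ (true ∷ _) (false ∷ _) (true ∷ _) _ b≢d _ (refl , _) (refl , _) _ = b≢d refl
noSquare⇒¬cycle P _ (false ∷ _) _ (false ∷ _) (true ∷ _) a≢c _ _ _ (refl , _) (refl , _) = a≢c refl
noSquare⇒¬cycle P _ (true ∷ _) _ (true ∷ _) (false ∷ _) a≢c _ _ _ (refl , _) (refl , _) = a≢c refl
noSquare⇒¬cycle P _ (false ∷ _) (true ∷ _) _ (true ∷ _) _ b≢d (refl , _) _ _ (refl , _) = b≢d refl
noSquare⇒¬cycle P _ (true ∷ _) (false ∷ _) _ (false ∷ _) _ b≢d (refl , _) _ _ (refl , _) = b≢d refl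

noSquare⇒C4Free : (P : Graph n) → NoSquare P → C4Free (edges P)
noSquare⇒C4Free P ns (a , b , c , d , (_ , a≢c , _ , _ , b≢d , _) , ab , bc , cd , da) =
  noSquare⇒¬cycle P ns a b c d a≢c b≢d
    (HasEdge⇒Adj P ab) (HasEdge⇒Adj P bc) (HasEdge⇒Adj P cd) (HasEdge⇒Adj P da)

allBool? : {R : Bool → Set} → Decidable R → Dec (∀ b → R b)
allBool? R? = map′ (λ { (f , t) false → f ; (f , t) true → t }) (λ r → r false , r true)
                   (R? false ×-dec R? true)

allVertex? : {R : Vertex n → Set} → Decidable R → Dec (∀ v → R v)
allVertex? {zero}  R? = map′ (λ { r [] → r }) (λ r → r []) (R? [])
allVertex? {suc n} R? = map′ (λ { r (b ∷ v) → r b v }) (λ r b v → r (b ∷ v))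
                             (allBool? λ b → allVertex? λ v → R? (b ∷ v))

noPrism? : (P Q : Graph n) (S : Vertex n → Bool) → Dec (NoPrism P Q S)
noPrism? {zero}  P Q S = yes tt
noPrism? {suc n} P Q S =
        allBool? (λ b → noPrism? (side b P) (side b Q) (S ∘ (b ∷_)))
  ×-dec allVertex? (λ v → ¬? (T? _ ×-dec T? _ ×-dec T? _ ×-dec T? _))

noSquare? : (P : Graph n) → Dec (NoSquare P)
noSquare? {zero}  P = yes tt
noSquare? {suc n} P =
  allBool? (λ b → noSquare? (side b P)) ×-dec noPrism? (side false P) (side true P) (rungs P)

-- Both premises are decision results: for a concrete graph that passes they evaluate to the unit
-- type, and `tt` proves them.
exQC4≥-graph : ∀ {k} (P : Graph n) → True (noSquare? P) → T (k ≤ᵇ length (edges P)) → exQC4≥ n k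
exQC4≥-graph P ns k≤ =
  edges P , (edges-QAdj P , edges-distinct P) , noSquare⇒C4Free P (toWitness ns) , ≤ᵇ⇒≤ _ _ k≤

index : Vertex n → ℕ
index []      = 0
index (b ∷ v) = (if b then 1 else 0) + 2 * index v

bit : ℕ → ℕ → Bool
bit m k = (_/_ m (2 ^ k) {{m^n≢0 2 k}}) % 2 ≡ᵇ 1

-- Bit number (index v) of the i-th code says whether v is joined to its
-- neighbour in direction i.
decode : Vec ℕ n → Graph n
decode cs v i = bit (lookup cs i) (index v)

-- Each code has 128 bits, one per vertex, and the two ends of an edge carry equal bits. Thus
-- direction 0 uses only the digits 0, 3, C and F, and the last code repeats its first half.
G₇ : Graph 7
G₇ = decode
  ( 0xCF0FFCC3F33C3F0FC3FC0FCF0F3F3CF3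
  ∷ 0xF5A5AFF05FF0FA5AF05F5AFAA5F5F0AF
  ∷ 0xBBFF88FF11FFDDFFFF44FF77FFEEFF22
  ∷ 0xD6D67F7FEFEFB6B6BFBFE9E97979DFDF
  ∷ 0x7B2D7B2DED4BED4B1EB71EB787DE87DE
  ∷ 0xBE78D7E1BE78D7E1D2EBB47DD2EBB47D
  ∷ 0x6DFBF79EFE976BFD6DFBF79EFE976BFD
  ∷ [])

G₈ : Graph 8
G₈ = decode
  ( 0x0FFCF3FFFC0FFC030F3F3CCFFCF3303FFFF0CC3C3333CCF3C30CFCFFCFCF3FFC
  ∷ 0x55AFA05A5FA5AFAFA5F5FFF55F5FF5FAA55AFF0FF0FF0F50FF505FAAFAFAFAAF
  ∷ 0xCC7711AABBFF7777FFEECCBB44EEBB22AAFF66FF5599AADD33DDBB667777DD77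
  ∷ 0xFBFBAEAEF4F4C3C379793B3B63639F9F5F5FF9F99A9A7F7FEFEF57579696D8D8
  ∷ 0xFD57FD57569E569E7BC67BC6EEEDEEED8BD28BD2FFE5FFE5BCFBBCFBC978C978
  ∷ 0x3BCB6FFD3BCB6FFDFB1E91CAFB1E91CADDE7562FDDE7562F6DEBE7976DEBE797
  ∷ 0xA6DBDFB599F1DE7DA6DBDFB599F1DE7D713EB9E83ECDF7AF713EB9E83ECDF7AF
  ∷ 0xF6AD7FD7EF7EB9FADEB7E679B7BD6FD7F6AD7FD7EF7EB9FADEB7E679B7BD6FD7
  ∷ [])

theorem1p1 : exQC4≥ 7 304 × exQC4≥ 8 680
theorem1p1 = exQC4≥-graph G₇ tt tt , exQC4≥-graph G₈ tt tt
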